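{- Let $G$ be a cubic graph and $M$ a maximal matching of $G$. Then $M$ admits a dominating transversal if and only if the formula $\Phi(G,M)$ is satisfiable. In particular, if $\Phi(G,M)$ is satisfiable for some minimum maximal matching $M$ of $G$, then $\gamma(G) \le \gamma_e(G)$.
   Context: Graphs are finite, simple and undirected; cubic means $3$-regular. The domination number $\gamma(G)$ is the minimum size of a set $S$ of vertices such that every vertex outside $S$ has a neighbour in $S$. A matching is a set of edges no two of which share a vertex; it is maximal if no edge of $G$ can be added to it. The edge domination number $\gamma_e(G)$ is the minimum size of a maximal matching, and a minimum maximal matching is a maximal matching of that size. For a matching $M$, $V(M)$ is the set of vertices lying on edges of $M$; the other vertices are unsaturated. A transversal of $M$ is a set $T \subseteq V(M)$ containing exactly one endpoint of each edge of $M$ (the chosen endpoint); it is dominating if every unsaturated vertex has a neighbour in $T$. An unsaturated vertex $u$ is at risk if its three neighbours lie on three distinct edges of $M$. The formula $\Phi(G,M)$: each edge $e \in M$ carries a Boolean variable $x_e$ whose two truth values name the two endpoints of $e$ (so a truth assignment corresponds to a transversal, the value of $x_e$ naming the chosen endpoint). For an at-risk vertex $u$ with neighbours on the distinct $M$-edges $e_1,e_2,e_3$, let $\ell_i$ be the literal on $x_{e_i}$ that is true exactly when the endpoint of $e_i$ adjacent to $u$ is chosen; the clause of $u$ is $\ell_1 \vee \ell_2 \vee \ell_3$. $\Phi(G,M)$ is the conjunction of the clauses of all at-risk vertices. -}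

module Defs where

open import Data.Bool.Base using (Bool; true; false; not)
open import Data.Bool.Properties using () renaming (_≟_ to _≟ᵇ_)
open import Data.Fin.Base using (Fin)
open import Data.Fin.Properties using (_≟_; any?; all?)
open import Data.Fin.Subset
open import Data.Fin.Subset.Induction using (⊃-wellFounded)
open import Data.Fin.Subset.Properties
  using (_∈?_; anySubset?; p⊆p∪q; q⊆p∪q; x∈⁅x⁆; ∈⊤; ∉⊥)
open import Data.List.Base using (List; []; _∷_; mapMaybe; allFin)
open import Data.List.Relation.Unary.All using (All)
open import Data.List.Relation.Unary.Any using (Any)
open import Data.Maybe.Base as Maybe using (Maybe)
open import Data.Nat.Base using (ℕ; _≤_; _<_)
open import Data.Nat.Properties using (_<?_; ≮⇒≥)
open import Data.Nat.Induction using (<-wellFounded)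
open import Data.Product using (∃; ∃!; _×_; _,_; proj₁; proj₂)
open import Data.Sum.Base using (inj₁; inj₂; [_,_]′)
open import Data.Vec.Base using (tabulate)
open import Data.Vec.Properties using (≡-dec)
open import Function.Base using (_∘_; _on_)
open import Function.Bundles using (_⇔_)
open import Induction.WellFounded using (Acc; acc)
import Relation.Binary.Construct.On as On
open import Relation.Binary.PropositionalEquality.Core using (_≡_; _≢_)
open import Relation.Nullary.Decidable.Core
  using (Dec; yes; no; does; map′; ¬?; _×-dec_; _⊎-dec_; _→-dec_; dec⇒maybe)
open import Relation.Nullary.Negation.Core using (¬_; contradiction)
open import Relation.Unary using (Pred; Decidable)
open import Level using (0ℓ)

-- The edge set is enumerated as Fin #E, and the two endpoints of an edge are
-- named by the two Booleans.  The naming is arbitrary and carries no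
-- orientation: incidence and adjacency do not depend on it.
record Graph : Set where
  field
    #V #E : ℕ

  Vertex : Set
  Vertex = Fin #V

  Edge : Set
  Edge = Fin #E

  field
    end : Edge → Bool → Vertex

  _onEdge_ : Vertex → Edge → Set
  v onEdge e = ∃ λ b → end e b ≡ v

  field
    loopless    : ∀ e → end e true ≢ end e false
    no-parallel : ∀ e f → (∀ v → (v onEdge e) ⇔ (v onEdge f)) → e ≡ f

  Adj : Vertex → Vertex → Set
  Adj u v = ∃ λ e → ∃ λ b → end e b ≡ u × end e (not b) ≡ v

IsSmallest : ∀ {n} → Pred (Subset n) 0ℓ → Pred (Subset n) 0ℓ
IsSmallest P p = P p × (∀ q → P q → ∣ p ∣ ≤ ∣ q ∣)

smallest : ∀ {n} {P : Pred (Subset n) 0ℓ} → Decidable P → ∃ P → ∃ (IsSmallest P)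
smallest {P = P} P? (p , Pp) = go p Pp (On.wellFounded ∣_∣ <-wellFounded p)
  where
  go : ∀ p → P p → Acc (_<_ on ∣_∣) p → ∃ (IsSmallest P)
  go p Pp (acc rec) with anySubset? (λ q → P? q ×-dec (∣ q ∣ <? ∣ p ∣))
  ... | yes (q , Pq , q<p) = go q Pq (rec q<p)
  ... | no ∄q = p , Pp , λ q Pq → ≮⇒≥ λ q<p → ∄q (q , Pq , q<p)

minSize : ∀ {n} {P : Pred (Subset n) 0ℓ} → Decidable P → ∃ P → ℕ
minSize P? ∃P = ∣ proj₁ (smallest P? ∃P) ∣

-- (x , true) is the literal x and (x , false) its negation.
Literal Clause CNF : Set → Set
Literal X = X × Bool
Clause  X = List (Literal X)
CNF     X = List (Clause X)

Satisfies : {X : Set} → (X → Bool) → CNF X → Set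
Satisfies σ = All (Any λ (x , b) → σ x ≡ b)

Satisfiable : {X : Set} → CNF X → Set
Satisfiable {X} φ = ∃ λ (σ : X → Bool) → Satisfies σ φ

private
  anyBool? : {P : Bool → Set} → (∀ b → Dec (P b)) → Dec (∃ P)
  anyBool? P? = map′ [ (true ,_) , (false ,_) ]′
                     (λ { (true , p) → inj₁ p ; (false , p) → inj₂ p })
                     (P? true ⊎-dec P? false)

module _ (G : Graph) where
  open Graph G

  onEdge? : ∀ v e → Dec (v onEdge e)
  onEdge? v e = anyBool? λ b → end e b ≟ v

  adj? : ∀ u v → Dec (Adj u v)
  adj? u v = any? λ e → anyBool? λ b → (end e b ≟ u) ×-dec (end e (not b) ≟ v)

  neighbourhood : Vertex → Subset #V
  neighbourhood u = tabulate (does ∘ adj? u)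

  Cubic : Set
  Cubic = ∀ u → ∣ neighbourhood u ∣ ≡ 3

  IsDominating : Subset #V → Set
  IsDominating S = ∀ u → u ∉ S → ∃ λ v → v ∈ S × Adj u v

  IsMatching : Subset #E → Set
  IsMatching M = ∀ e f v → e ∈ M → f ∈ M → v onEdge e → v onEdge f → e ≡ f

  IsMaximalMatching : Subset #E → Set
  IsMaximalMatching M = IsMatching M × (∀ e → e ∉ M → ¬ IsMatching (M ∪ ⁅ e ⁆))

  isDominating? : Decidable IsDominating
  isDominating? S = all? λ u → ¬? (u ∈? S) →-dec any? λ v → (v ∈? S) ×-dec adj? u v

  isMatching? : Decidable IsMatching
  isMatching? M = all? λ e → all? λ f → all? λ v →
    (e ∈? M) →-dec (f ∈? M) →-dec onEdge? v e →-dec onEdge? v f →-dec (e ≟ f)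

  isMaximalMatching? : Decidable IsMaximalMatching
  isMaximalMatching? M =
    isMatching? M ×-dec all? λ e → ¬? (e ∈? M) →-dec ¬? (isMatching? (M ∪ ⁅ e ⁆))

  ∃dominating : ∃ IsDominating
  ∃dominating = ⊤ , λ u u∉⊤ → contradiction ∈⊤ u∉⊤

  ∃maximalMatching : ∃ IsMaximalMatching
  ∃maximalMatching = extend ⊥ (λ e f v e∈⊥ → contradiction e∈⊥ ∉⊥) (⊃-wellFounded ⊥)
    where
    extend : ∀ M → IsMatching M → Acc _⊃_ M → ∃ IsMaximalMatching
    extend M matching (acc rec)
      with any? (λ e → ¬? (e ∈? M) ×-dec isMatching? (M ∪ ⁅ e ⁆))
    ... | yes (e , e∉M , matching⁺) = extend (M ∪ ⁅ e ⁆) matching⁺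
            (rec (p⊆p∪q ⁅ e ⁆ , e , q⊆p∪q M ⁅ e ⁆ (x∈⁅x⁆ e) , e∉M))
    ... | no ∄e = M , matching , λ e e∉M matching⁺ → ∄e (e , e∉M , matching⁺)

  γ : ℕ
  γ = minSize isDominating? ∃dominating

  γₑ : ℕ
  γₑ = minSize isMaximalMatching? ∃maximalMatching

  IsMinimumMaximalMatching : Subset #E → Set
  IsMinimumMaximalMatching M = IsMaximalMatching M × ∣ M ∣ ≡ γₑ

  module _ (M : Subset #E) where

    Saturated : Vertex → Set
    Saturated v = ∃ λ e → e ∈ M × v onEdge e

    saturated? : Decidable Saturated
    saturated? v = any? λ e → (e ∈? M) ×-dec onEdge? v e

    IsTransversal : Subset #V → Set
    IsTransversal T = (∀ v → v ∈ T → Saturated v)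
                    × (∀ e → e ∈ M → ∃! _≡_ λ v → v onEdge e × v ∈ T)

    IsDominatingTransversal : Subset #V → Set
    IsDominatingTransversal T =
      IsTransversal T × (∀ u → ¬ Saturated u → ∃ λ v → v ∈ T × Adj u v)

    OnThreeEdges : (v₁ v₂ v₃ : Vertex) (e₁ e₂ e₃ : Edge) → Set
    OnThreeEdges v₁ v₂ v₃ e₁ e₂ e₃ =
        (e₁ ∈ M × v₁ onEdge e₁)
      × (e₂ ∈ M × v₂ onEdge e₂)
      × (e₃ ∈ M × v₃ onEdge e₃)
      × e₁ ≢ e₂ × e₁ ≢ e₃ × e₂ ≢ e₃

    AtRisk : Vertex → Set
    AtRisk u = ¬ Saturated u
      × ∃ λ v₁ → ∃ λ v₂ → ∃ λ v₃ → neighbourhood u ≡ ⁅ v₁ ⁆ ∪ ⁅ v₂ ⁆ ∪ ⁅ v₃ ⁆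
      × ∃ λ e₁ → ∃ λ e₂ → ∃ λ e₃ → OnThreeEdges v₁ v₂ v₃ e₁ e₂ e₃

    atRisk? : Decidable AtRisk
    atRisk? u = ¬? (saturated? u)
      ×-dec any? λ v₁ → any? λ v₂ → any? λ v₃ →
              ≡-dec _≟ᵇ_ (neighbourhood u) (⁅ v₁ ⁆ ∪ ⁅ v₂ ⁆ ∪ ⁅ v₃ ⁆)
      ×-dec any? λ e₁ → any? λ e₂ → any? λ e₃ →
              ((e₁ ∈? M) ×-dec onEdge? v₁ e₁)
        ×-dec ((e₂ ∈? M) ×-dec onEdge? v₂ e₂)
        ×-dec ((e₃ ∈? M) ×-dec onEdge? v₃ e₃)
        ×-dec ¬? (e₁ ≟ e₂) ×-dec ¬? (e₁ ≟ e₃) ×-dec ¬? (e₂ ≟ e₃)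

    -- x_e takes the value b when the chosen endpoint of e is end e b.
    Var : Set
    Var = ∃ λ e → e ∈ M

    -- The literal on x_e that is true exactly when v is the chosen endpoint.
    literal : ∀ {v e} → e ∈ M × v onEdge e → Literal Var
    literal {e = e} (e∈M , b , _) = (e , e∈M) , b

    clause : ∀ {u} → AtRisk u → Clause Var
    clause (_ , _ , _ , _ , _ , _ , _ , _ , on₁ , on₂ , on₃ , _) =
      literal on₁ ∷ literal on₂ ∷ literal on₃ ∷ []

    Φ : CNF Var
    Φ = mapMaybe (λ u → Maybe.map clause (dec⇒maybe (atRisk? u))) (allFin #V)

{-# OPTIONS --safe #-}
-- A transversal of M is the same thing as a truth assignment σ, and a literal is true exactly
-- when its endpoint is chosen.  By maximality of M the neighbours of an unsaturated vertex u are
-- all saturated.  If two of the three lie on the same edge of M, they are its two endpoints and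
-- one of them is chosen whatever σ is; otherwise u is at risk and is dominated exactly when its
-- clause is true.  A dominating transversal dominates G, since a vertex of V(M) outside it is
-- adjacent to its partner, and it has at most |M| vertices.
module Submission where

open import Defs
open import Data.Bool.Base using (Bool; true; false; not)
open import Data.Bool.Properties using (T-≡; ¬-not) renaming (_≟_ to _≟ᵇ_)
open import Data.Fin.Base using (Fin; zero; suc)
open import Data.Fin.Properties using (_≟_; any?; suc-injective)
open import Data.Nat.Base using (suc; _≤_; z≤n)
open import Data.Nat.Properties using (≤-trans; ≤-reflexive; ≤-<-trans)
  renaming (suc-injective to ℕ-suc-injective)
open import Data.Fin.Subset using (Subset; _∈_; _∉_; _∪_; ⁅_⁆; _-_; ⊥; ∣_∣; inside; outside)
open import Data.Fin.Subset.Properties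
  using (_∈?_; x∈p∪q⁻; x∈p∪q⁺; x∈⁅x⁆; x∈⁅y⁆⇒x≡y; ∪-identityˡ; ∪-identityʳ;
         x∈p⇒∣p-x∣<∣p∣; x∈p∧x≢y⇒x∈p-y; drop-there)
open import Data.List.Base using ([]; _∷_; map; mapMaybe)
open import Data.List.Relation.Unary.All using (All; []; _∷_)
open import Data.List.Relation.Unary.All.Properties
  using (map⁺; map⁻; mapMaybe⁺; tabulate⁺; tabulate⁻)
open import Data.List.Relation.Unary.Any using (Any; here; there)
open import Data.Maybe.Base as Maybe using (Maybe; just; nothing)
open import Data.Maybe.Relation.Unary.All as MaybeAll using (just; nothing)
open import Data.Product.Base using (∃; _×_; _,_; proj₁; proj₂)
open import Data.Sum.Base using (_⊎_; inj₁; inj₂)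
import Data.Vec.Base as Vec
open import Data.Vec.Properties using ([]=⇒lookup; lookup⇒[]=; lookup∘tabulate)
open import Data.Vec.Properties.WithK using ([]=-irrelevant)
open import Function.Base using (_∘_)
open import Function.Bundles using (_⇔_; mk⇔; Equivalence)
open import Level using (0ℓ)
open import Relation.Binary.PropositionalEquality
  using (_≡_; _≢_; refl; sym; trans; cong; subst)
open import Relation.Nullary.Decidable
  using (Dec; yes; no; does; map′; dec-true; isYes≗does; toWitness; decidable-stable; dec⇒maybe)
open import Relation.Nullary.Negation using (¬_; contradiction)
open import Relation.Unary using (Pred; Decidable)

-- Finite subsets: comprehension, three-element sets, comparison of sizes

module _ {n} {P : Pred (Fin n) 0ℓ} (P? : Decidable P) where

  ∈-tabulate⁺ : ∀ {x} → P x → x ∈ Vec.tabulate (does ∘ P?)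
  ∈-tabulate⁺ {x} Px =
    lookup⇒[]= x _ (trans (lookup∘tabulate (does ∘ P?) x) (dec-true (P? x) Px))

  ∈-tabulate⁻ : ∀ {x} → x ∈ Vec.tabulate (does ∘ P?) → P x
  ∈-tabulate⁻ {x} x∈p = toWitness {a? = P? x} (Equivalence.from T-≡
    (trans (isYes≗does (P? x)) (trans (sym (lookup∘tabulate (does ∘ P?) x)) ([]=⇒lookup x∈p))))

∣p∣≡0⇒p≡⊥ : ∀ {n} (p : Subset n) → ∣ p ∣ ≡ 0 → p ≡ ⊥
∣p∣≡0⇒p≡⊥ Vec.[]              _  = refl
∣p∣≡0⇒p≡⊥ (outside Vec.∷ p) eq = cong (outside Vec.∷_) (∣p∣≡0⇒p≡⊥ p eq)

-- Splits off the least element. Recording `x ∉ q` is what makes the points pairwise distinct when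
-- the splitting is iterated.
∣p∣≡1+n⇒p≡⁅x⁆∪q : ∀ {m n} (p : Subset m) → ∣ p ∣ ≡ suc n →
                  ∃ λ x → ∃ λ q → p ≡ ⁅ x ⁆ ∪ q × x ∉ q × ∣ q ∣ ≡ n
∣p∣≡1+n⇒p≡⁅x⁆∪q (inside Vec.∷ p) eq =
  zero , outside Vec.∷ p , cong (inside Vec.∷_) (sym (∪-identityˡ p)) , (λ ()) ,
  ℕ-suc-injective eq
∣p∣≡1+n⇒p≡⁅x⁆∪q (outside Vec.∷ p) eq with ∣p∣≡1+n⇒p≡⁅x⁆∪q p eq
... | x , q , p≡ , x∉q , ∣q∣≡n =
  suc x , outside Vec.∷ q , cong (outside Vec.∷_) p≡ , x∉q ∘ drop-there , ∣q∣≡n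

∣p∣≡3⇒triple : ∀ {n} (p : Subset n) → ∣ p ∣ ≡ 3 →
  ∃ λ x → ∃ λ y → ∃ λ z → p ≡ ⁅ x ⁆ ∪ ⁅ y ⁆ ∪ ⁅ z ⁆ × x ≢ y × x ≢ z × y ≢ z
∣p∣≡3⇒triple p ∣p∣≡3
  with x , q , refl , x∉q , ∣q∣≡2 ← ∣p∣≡1+n⇒p≡⁅x⁆∪q p ∣p∣≡3
  with y , r , refl , y∉r , ∣r∣≡1 ← ∣p∣≡1+n⇒p≡⁅x⁆∪q q ∣q∣≡2
  with z , s , refl , z∉s , ∣s∣≡0 ← ∣p∣≡1+n⇒p≡⁅x⁆∪q r ∣r∣≡1
  with refl ← ∣p∣≡0⇒p≡⊥ s ∣s∣≡0
  = x , y , z , cong (λ t → ⁅ x ⁆ ∪ ⁅ y ⁆ ∪ t) (∪-identityʳ ⁅ z ⁆)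
  , (λ { refl → x∉q (x∈p∪q⁺ (inj₁ (x∈⁅x⁆ x))) })
  , (λ { refl → x∉q (x∈p∪q⁺ (inj₂ (x∈p∪q⁺ (inj₁ (x∈⁅x⁆ x))))) })
  , (λ { refl → y∉r (x∈p∪q⁺ (inj₁ (x∈⁅x⁆ y))) })

∈-triple⁻ : ∀ {n} {w : Fin n} x y z → w ∈ ⁅ x ⁆ ∪ ⁅ y ⁆ ∪ ⁅ z ⁆ → w ≡ x ⊎ w ≡ y ⊎ w ≡ z
∈-triple⁻ x y z w∈ with x∈p∪q⁻ ⁅ x ⁆ (⁅ y ⁆ ∪ ⁅ z ⁆) w∈
... | inj₁ w∈x = inj₁ (x∈⁅y⁆⇒x≡y x w∈x)
... | inj₂ w∈yz with x∈p∪q⁻ ⁅ y ⁆ ⁅ z ⁆ w∈yz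
...   | inj₁ w∈y = inj₂ (inj₁ (x∈⁅y⁆⇒x≡y y w∈y))
...   | inj₂ w∈z = inj₂ (inj₂ (x∈⁅y⁆⇒x≡y z w∈z))

-- Induction on `p`: a first element that is present uses up one partner, which is deleted from `q`.
-- A relation in place of a function lets each partner be produced from a membership proof.
injectiveRelation⇒∣p∣≤∣q∣ : ∀ {m n} {R : Fin m → Fin n → Set} (p : Subset m) (q : Subset n) →
  (∀ {x} → x ∈ p → ∃ λ y → y ∈ q × R x y) →
  (∀ {x x′ y} → R x y → R x′ y → x ≡ x′) → ∣ p ∣ ≤ ∣ q ∣
injectiveRelation⇒∣p∣≤∣q∣ Vec.[] q total injective = z≤n
injectiveRelation⇒∣p∣≤∣q∣ (outside Vec.∷ p) q total injective =
  injectiveRelation⇒∣p∣≤∣q∣ p q (total ∘ Vec.there)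
    (λ r r′ → suc-injective (injective r r′))
injectiveRelation⇒∣p∣≤∣q∣ {R = R} (inside Vec.∷ p) q total injective
  with y₀ , y₀∈q , r₀ ← total Vec.here =
  ≤-<-trans
    (injectiveRelation⇒∣p∣≤∣q∣ p (q - y₀) total′ (λ r r′ → suc-injective (injective r r′)))
    (x∈p⇒∣p-x∣<∣p∣ y₀∈q)
  where
  total′ : ∀ {x} → x ∈ p → ∃ λ y → y ∈ q - y₀ × R (suc x) y
  total′ x∈p with y , y∈q , r ← total (Vec.there x∈p) =
    -- A later element related to `y₀` would equal the first one by injectivity, so deleting `y₀`
    -- costs it no partner.
    y , x∈p∧x≢y⇒x∈p-y y∈q (λ { refl → contradiction (injective r r₀) λ () }) , r

-- Minimum sizes, and lists filtered by a decision

minSize≤ : ∀ {n} {P : Pred (Subset n) 0ℓ} (P? : Decidable P) (∃P : ∃ P) →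
           ∀ {p} → P p → minSize P? ∃P ≤ ∣ p ∣
minSize≤ P? ∃P {p} = proj₂ (proj₂ (smallest P? ∃P)) p

-- Keeping the discarded entries as `nothing` preserves positions, so that the result can afterwards
-- be looked up at a given index.
mapMaybe⁻ : ∀ {A B : Set} {P : Pred B 0ℓ} {f : A → Maybe B} xs →
            All P (mapMaybe f xs) → All (MaybeAll.All P) (map f xs)
mapMaybe⁻         []       []  = []
mapMaybe⁻ {f = f} (x ∷ xs) ps with f x
mapMaybe⁻ (x ∷ xs) ps       | nothing = nothing ∷ mapMaybe⁻ xs ps
mapMaybe⁻ (x ∷ xs) (p ∷ ps) | just _  = just p ∷ mapMaybe⁻ xs ps

module _ {A B : Set} {P : Pred B 0ℓ} (f : A → B) where

  dec⇒maybe⁺ : (a? : Dec A) → (∀ a → P (f a)) → MaybeAll.All P (Maybe.map f (dec⇒maybe a?))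
  dec⇒maybe⁺ (yes a) Pf = just (Pf a)
  dec⇒maybe⁺ (no _)  Pf = nothing

  -- The given proof of `A` only excludes the `no` case; the `a` returned is the one carried by the
  -- decision.
  dec⇒maybe⁻ : (a? : Dec A) → MaybeAll.All P (Maybe.map f (dec⇒maybe a?)) → A → ∃ λ a → P (f a)
  dec⇒maybe⁻ (yes a) (just Pfa) _ = a , Pfa
  dec⇒maybe⁻ (no ¬a) _          a = contradiction a ¬a

≢⇒exhaustive : ∀ {x y : Bool} z → x ≢ y → z ≡ x ⊎ z ≡ y
≢⇒exhaustive {x} {y} z x≢y with z ≟ᵇ x
... | yes z≡x = inj₁ z≡x
... | no  z≢x = inj₂ (trans (¬-not z≢x) (sym (¬-not (x≢y ∘ sym))))

Satisfies-clause : {X : Set} → (X → Bool) → Clause X → Set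
Satisfies-clause σ = Any λ (x , b) → σ x ≡ b

-- Ends of edges and neighbourhoods

module _ (G : Graph) where
  open Graph G

  end-injective : ∀ e {b c} → end e b ≡ end e c → b ≡ c
  end-injective e {true}  {true}  _  = refl
  end-injective e {false} {false} _  = refl
  end-injective e {true}  {false} eq = contradiction eq (loopless e)
  end-injective e {false} {true}  eq = contradiction (sym eq) (loopless e)

  end≡either : ∀ {v w e} → v onEdge e → w onEdge e → v ≢ w → ∀ b → end e b ≡ v ⊎ end e b ≡ w
  -- Distinct ends have distinct Boolean names, and `b` must be one of the two.
  end≡either {e = e} (c , refl) (d , refl) v≢w b with ≢⇒exhaustive b (v≢w ∘ cong (end e))
  ... | inj₁ refl = inj₁ refl
  ... | inj₂ refl = inj₂ refl

  end-not≡ : ∀ {v e} b → v onEdge e → end e b ≢ v → end e (not b) ≡ v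
  end-not≡ {e = e} b (c , refl) b≢c = cong (end e) (sym (¬-not (b≢c ∘ cong (end e) ∘ sym)))

  Adj⇒∈neighbourhood : ∀ {u v} → Adj u v → v ∈ neighbourhood G u
  Adj⇒∈neighbourhood {u} = ∈-tabulate⁺ (adj? G u)

  neighbourhood≡triple⇒Adj : ∀ {u x y z} → neighbourhood G u ≡ ⁅ x ⁆ ∪ ⁅ y ⁆ ∪ ⁅ z ⁆ →
                             Adj u x × Adj u y × Adj u z
  neighbourhood≡triple⇒Adj {u} {x} {y} {z} nbhd =
    adj (x∈p∪q⁺ (inj₁ (x∈⁅x⁆ x))) ,
    adj (x∈p∪q⁺ (inj₂ (x∈p∪q⁺ (inj₁ (x∈⁅x⁆ y))))) ,
    adj (x∈p∪q⁺ (inj₂ (x∈p∪q⁺ (inj₂ (x∈⁅x⁆ z)))))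
    where
    adj : ∀ {v} → v ∈ ⁅ x ⁆ ∪ ⁅ y ⁆ ∪ ⁅ z ⁆ → Adj u v
    adj {v} = ∈-tabulate⁻ (adj? G u) ∘ subst (v ∈_) (sym nbhd)

  -- Maximality of the matching, and access to the clauses of `Φ`

  module _ (M : Subset #E) where

    -- If `v` were unsaturated as well, the edge joining `u` and `v` would lie outside `M` and meet
    -- no edge of `M`, so adding it would contradict maximality.
    neighbour-saturated : IsMaximalMatching G M →
      ∀ {u v} → ¬ Saturated G M u → Adj u v → Saturated G M v
    neighbour-saturated (matching , maximal) {u} {v} ¬su (e , b , refl , refl) =
      decidable-stable (saturated? G M v) λ ¬sv →
        maximal e (λ e∈M → ¬su (e , e∈M , b , refl)) (matching⁺ ¬sv)
      where
      e-unsaturated : ¬ Saturated G M v → ∀ {f w} → f ∈ M → w onEdge f → ¬ w onEdge e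
      e-unsaturated ¬sv {f} {w} f∈M w-f w-e with end e b ≟ w
      ... | yes refl = ¬su (f , f∈M , w-f)
      ... | no  b≢w  = ¬sv (f , f∈M , subst (_onEdge f) (sym (end-not≡ b w-e b≢w)) w-f)

      matching⁺ : ¬ Saturated G M v → IsMatching G (M ∪ ⁅ e ⁆)
      matching⁺ ¬sv f g w f∈ g∈ w-f w-g with x∈p∪q⁻ M ⁅ e ⁆ f∈ | x∈p∪q⁻ M ⁅ e ⁆ g∈
      ... | inj₁ f∈M | inj₁ g∈M = matching f g w f∈M g∈M w-f w-g
      ... | inj₂ f∈e | inj₂ g∈e = trans (x∈⁅y⁆⇒x≡y e f∈e) (sym (x∈⁅y⁆⇒x≡y e g∈e))
      ... | inj₁ f∈M | inj₂ g∈e with refl ← x∈⁅y⁆⇒x≡y e g∈e =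
        contradiction w-g (e-unsaturated ¬sv f∈M w-f)
      ... | inj₂ f∈e | inj₁ g∈M with refl ← x∈⁅y⁆⇒x≡y e f∈e =
        contradiction w-f (e-unsaturated ¬sv g∈M w-g)

    satisfiesΦ⁺ : ∀ {σ} → (∀ {u} (a : AtRisk G M u) → Satisfies-clause σ (clause G M a)) →
                  Satisfies σ (Φ G M)
    satisfiesΦ⁺ sat = mapMaybe⁺ (map⁺ (tabulate⁺ λ u → dec⇒maybe⁺ (clause G M) (atRisk? G M u) sat))

    -- The clause in Φ comes from the witness found by atRisk?, which need not be the given one.
    satisfiesΦ⁻ : ∀ {σ} → Satisfies σ (Φ G M) → ∀ {u} → AtRisk G M u →
                  ∃ λ (a : AtRisk G M u) → Satisfies-clause σ (clause G M a)
    satisfiesΦ⁻ sat {u} =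
      dec⇒maybe⁻ (clause G M) (atRisk? G M u) (tabulate⁻ (map⁻ (mapMaybe⁻ _ sat)) u)

    -- From a transversal to an assignment

    module FromTransversal (T : Subset #V) (transversal : IsTransversal G M T) where

      assignment : Var G M → Bool
      assignment (e , e∈M) with (_ , ((b , _) , _) , _) ← proj₂ transversal e e∈M = b

      -- Uniqueness of the chosen endpoint identifies `v` with the end named by `assignment`; since
      -- `e` is not a loop, equal ends have equal names.
      literal-true : ∀ {v e} (on : e ∈ M × v onEdge e) → v ∈ T →
        let (x , b) = literal G M on in assignment x ≡ b
      literal-true {v} {e} (e∈M , b , refl) v∈T
        with (_ , ((c , refl) , _) , unique) ← proj₂ transversal e e∈M =
        end-injective e (unique ((b , refl) , v∈T))

      satisfies : (∀ u → ¬ Saturated G M u → ∃ λ v → v ∈ T × Adj u v) →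
                  Satisfies assignment (Φ G M)
      satisfies dominating = satisfiesΦ⁺ clause-true
        where
        clause-true : ∀ {u} (a : AtRisk G M u) → Satisfies-clause assignment (clause G M a)
        clause-true {u} (¬su , v₁ , v₂ , v₃ , nbhd , _ , _ , _ , on₁ , on₂ , on₃ , _)
          with v , v∈T , u~v ← dominating u ¬su
          with ∈-triple⁻ v₁ v₂ v₃ (subst (v ∈_) nbhd (Adj⇒∈neighbourhood u~v))
        ... | inj₁ refl        = here (literal-true on₁ v∈T)
        ... | inj₂ (inj₁ refl) = there (here (literal-true on₂ v∈T))
        ... | inj₂ (inj₂ refl) = there (there (here (literal-true on₃ v∈T)))

      size : ∣ T ∣ ≤ ∣ M ∣
      -- Each vertex of `T` is related to an edge of `M` through it. Both memberships are part of
      -- the relation because injectivity rests on the uniqueness of the chosen endpoint.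
      size = injectiveRelation⇒∣p∣≤∣q∣ {R = λ v e → v ∈ T × e ∈ M × v onEdge e} T M
        (λ {v} v∈T → let (e , e∈M , v-e) = proj₁ transversal v v∈T in e , e∈M , v∈T , e∈M , v-e)
        (λ {_} {_} {e} (v∈T , e∈M , v-e) (w∈T , _ , w-e) →
          let (_ , _ , unique) = proj₂ transversal e e∈M in
          trans (sym (unique (v-e , v∈T))) (unique (w-e , w∈T)))

      isDominating : (∀ u → ¬ Saturated G M u → ∃ λ v → v ∈ T × Adj u v) → IsDominating G T
      isDominating dominating u u∉T with saturated? G M u
      ... | no ¬su = dominating u ¬su
      ... | yes (e , e∈M , b , refl)
        with v , (v-e , v∈T) , _ ← proj₂ transversal e e∈M =
        -- The chosen endpoint `v` of `e` lies in `T` and `u` does not, so `v` is the other end of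
        -- `e`.
        v , v∈T , e , b , refl , end-not≡ b v-e λ { refl → u∉T v∈T }

    -- From an assignment to a transversal

    module FromAssignment (matching : IsMatching G M) (σ : Var G M → Bool) where

      -- A variable contains a proof that its edge is in `M`. Such proofs are all equal, so the
      -- chosen end depends on the edge alone.
      chosen-irrelevant : ∀ {e} (p q : e ∈ M) → end e (σ (e , p)) ≡ end e (σ (e , q))
      chosen-irrelevant {e} p q = cong (λ r → end e (σ (e , r))) ([]=-irrelevant p q)

      ChosenOn : Vertex → Edge → Set
      ChosenOn v e = ∃ λ (e∈M : e ∈ M) → end e (σ (e , e∈M)) ≡ v

      chosenOn? : ∀ v → Decidable (ChosenOn v)
      chosenOn? v e with e ∈? M
      ... | no  e∉M = no λ (e∈M , _) → e∉M e∈M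
      ... | yes e∈M = map′ (e∈M ,_) (λ (p , eq) → trans (chosen-irrelevant e∈M p) eq)
                           (end e (σ (e , e∈M)) ≟ v)

      chosen? : Decidable (∃ ∘ ChosenOn)
      chosen? v = any? (chosenOn? v)

      T : Subset #V
      T = Vec.tabulate (does ∘ chosen?)

      chosen∈T : ∀ e (e∈M : e ∈ M) → end e (σ (e , e∈M)) ∈ T
      chosen∈T e e∈M = ∈-tabulate⁺ chosen? (e , e∈M , refl)

      literal-true⇒∈T : ∀ {v e} (on : e ∈ M × v onEdge e) →
        (let (x , b) = literal G M on in σ x ≡ b) → v ∈ T
      literal-true⇒∈T {e = e} (e∈M , _ , refl) refl = chosen∈T e e∈M

      isTransversal : IsTransversal G M T
      isTransversal = saturated , λ e e∈M →
        end e (σ (e , e∈M)) , ((_ , refl) , chosen∈T e e∈M) , unique e e∈M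
        where
        saturated : ∀ v → v ∈ T → Saturated G M v
        saturated v v∈T with (e , e∈M , eq) ← ∈-tabulate⁻ chosen? v∈T = e , e∈M , _ , eq

        unique : ∀ e (e∈M : e ∈ M) {v} → v onEdge e × v ∈ T → end e (σ (e , e∈M)) ≡ v
        unique e e∈M {v} (v-e , v∈T)
          with (f , f∈M , eq) ← ∈-tabulate⁻ chosen? v∈T
          -- `v` was put into `T` by some edge `f` of `M`; as `e` also passes through `v`, the
          -- matching property gives `f = e`.
          with refl ← matching e f v e∈M f∈M v-e (_ , eq) =
          trans (chosen-irrelevant e∈M f∈M) eq

      Dominated : Vertex → Set
      Dominated u = ∃ λ v → v ∈ T × Adj u v

      shared-edge⇒dominated : ∀ {u v w e f} → e ∈ M × v onEdge e → f ∈ M × w onEdge f → e ≡ f →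
        v ≢ w → Adj u v → Adj u w → Dominated u
      shared-edge⇒dominated {e = e} (e∈M , v-e) (_ , w-e) refl v≢w u~v u~w
        -- `v` and `w` are the two ends of `e`, so whichever end `σ` chooses is a neighbour of `u`.
        with end≡either v-e w-e v≢w (σ (e , e∈M)) | chosen∈T e e∈M
      ... | inj₁ refl | v∈T = _ , v∈T , u~v
      ... | inj₂ refl | w∈T = _ , w∈T , u~w

      satisfied-clause⇒dominated : ∀ {u} (a : AtRisk G M u) →
        Satisfies-clause σ (clause G M a) → Dominated u
      satisfied-clause⇒dominated
        (_ , v₁ , v₂ , v₃ , nbhd , _ , _ , _ , on₁ , on₂ , on₃ , _) satisfied
        with u~v₁ , u~v₂ , u~v₃ ← neighbourhood≡triple⇒Adj nbhd | satisfied
      ... | here eq                 = v₁ , literal-true⇒∈T on₁ eq , u~v₁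
      ... | there (here eq)         = v₂ , literal-true⇒∈T on₂ eq , u~v₂
      ... | there (there (here eq)) = v₃ , literal-true⇒∈T on₃ eq , u~v₃

      dominating : Cubic G → IsMaximalMatching G M → Satisfies σ (Φ G M) →
                   ∀ u → ¬ Saturated G M u → Dominated u
      dominating cubic maximal sat u ¬su
        with v₁ , v₂ , v₃ , nbhd , v₁≢v₂ , v₁≢v₃ , v₂≢v₃ ← ∣p∣≡3⇒triple _ (cubic u)
        with u~v₁ , u~v₂ , u~v₃ ← neighbourhood≡triple⇒Adj nbhd
        = go (neighbour-saturated maximal ¬su u~v₁)
             (neighbour-saturated maximal ¬su u~v₂)
             (neighbour-saturated maximal ¬su u~v₃)
        where
        go : Saturated G M v₁ → Saturated G M v₂ → Saturated G M v₃ → Dominated u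
        -- Any coincidence among the three edges dominates `u` outright; if there is none, `u` is at
        -- risk and its clause decides.
        go (e₁ , on₁) (e₂ , on₂) (e₃ , on₃) with e₁ ≟ e₂ | e₁ ≟ e₃ | e₂ ≟ e₃
        ... | yes e₁≡e₂ | _ | _ = shared-edge⇒dominated on₁ on₂ e₁≡e₂ v₁≢v₂ u~v₁ u~v₂
        ... | no _ | yes e₁≡e₃ | _ = shared-edge⇒dominated on₁ on₃ e₁≡e₃ v₁≢v₃ u~v₁ u~v₃
        ... | no _ | no _ | yes e₂≡e₃ = shared-edge⇒dominated on₂ on₃ e₂≡e₃ v₂≢v₃ u~v₂ u~v₃
        ... | no e₁≢e₂ | no e₁≢e₃ | no e₂≢e₃
          with a , satisfied ← satisfiesΦ⁻ sat (¬su , v₁ , v₂ , v₃ , nbhd , e₁ , e₂ , e₃ ,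
                                                on₁ , on₂ , on₃ , e₁≢e₂ , e₁≢e₃ , e₂≢e₃)
          = satisfied-clause⇒dominated a satisfied

proposition6 : (G : Graph) → Cubic G →
    ((M : Subset (Graph.#E G)) → IsMaximalMatching G M →
    (∃ λ T → IsDominatingTransversal G M T) ⇔ Satisfiable (Φ G M))
    × ((∃ λ M → IsMinimumMaximalMatching G M × Satisfiable (Φ G M)) →
    γ G ≤ γₑ G)
proposition6 G cubic = equivalence , bound
  where
  transversal : ∀ M → IsMaximalMatching G M → Satisfiable (Φ G M) →
                ∃ λ T → IsDominatingTransversal G M T
  transversal M maximal (σ , sat) = T , isTransversal , dominating cubic maximal sat
    where open FromAssignment G M (proj₁ maximal) σ

  equivalence : ∀ M → IsMaximalMatching G M →
                (∃ λ T → IsDominatingTransversal G M T) ⇔ Satisfiable (Φ G M)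
  equivalence M maximal = mk⇔
    (λ (T , isT , dominating) → let open FromTransversal G M T isT in
      assignment , satisfies dominating)
    (transversal M maximal)

  bound : (∃ λ M → IsMinimumMaximalMatching G M × Satisfiable (Φ G M)) → γ G ≤ γₑ G
  bound (M , (maximal , ∣M∣≡γₑ) , sat) =
    let T , isT , dominating = transversal M maximal sat
        open FromTransversal G M T isT
    -- The chain is `γ G ≤ ∣ T ∣ ≤ ∣ M ∣ ≡ γₑ G`, where minimality of `M` enters only in the last
    -- equality.
    in ≤-trans (minSize≤ (isDominating? G) (∃dominating G) (isDominating dominating))
               (≤-trans size (≤-reflexive ∣M∣≡γₑ))
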